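{- There is an absolute constant $C>0$ such that for every CBGT instance $(E,\mathcal{I},g)$ with $n=|E|\ge 2$ elements there is an infinite valid schedule $\pi$ that is periodic with period $2n$ (i.e. $\pi(t+2n)=\pi(t)$ for all $t\in\mathbb{N}$) and satisfies $h(\pi)\le C\log n$. Furthermore, such a schedule can be computed by making at most $2n$ queries to a maximum-weight independent-set oracle for $\mathcal{I}$.
   Context: An instance of Combinatorial Bamboo Garden Trimming (CBGT) is a triple $(E,\mathcal{I},g)$ where $E$ is a finite set (of "bamboos"), $\mathcal{I}\subseteq 2^E$ is a family of subsets of $E$, and $g\in\mathbb{Q}_{\ge 0}^E$ is a vector of growth rates such that there are coefficients $\lambda(I)\ge 0$ ($I\in\mathcal{I}$) with $\sum_{I\in\mathcal{I}}\lambda(I)=1$ and $g(e)=\sum_{I\in\mathcal{I}:\, e\in I}\lambda(I)$ for every $e\in E$. Let $\mathbb{N}=\{1,2,\dots\}$. An infinite schedule is a sequence $\pi=\pi(1),\pi(2),\dots$ of subsets of $E$; it is valid if $\pi(t)\in\mathcal{I}$ for all $t\in\mathbb{N}$. $h^\pi_t(e)$ denotes the height of $e$ on day $t$ after growing but before $\pi(t)$ is cut, i.e. $h^\pi_1(e)=g(e)$, and $h^\pi_{t+1}(e)=g(e)$ if $e\in\pi(t)$, $h^\pi_{t+1}(e)=h^\pi_t(e)+g(e)$ otherwise. The height of $\pi$ is $h(\pi)=\max_{e\in E}\sup_{t\in\mathbb{N}}h^\pi_t(e)$. The algorithm is given $E$ and $g$ explicitly, and has access to $\mathcal{I}$ only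 through the oracle. A maximum-weight independent-set oracle for $\mathcal{I}$ takes non-negative weights $w_e\ge 0$ ($e\in E$) and returns a set $I\in\mathcal{I}$ maximizing $\sum_{e\in I}w_e$ over $\mathcal{I}$. -}

module Defs where

open import Data.Bool using (if_then_else_)
open import Data.Fin using (Fin)
open import Data.Fin.Subset using (Subset; _∈_)
open import Data.Fin.Subset.Properties using (_∈?_)
open import Data.Integer using (+_; -[1+_])
open import Data.List using (List; foldr; filter; allFin)
import Data.List.Membership.Propositional as List
open import Data.List.Relation.Unary.Unique.Propositional using (Unique)
open import Data.Nat using (ℕ; zero; suc; s≤s)
import Data.Nat as ℕ
open import Data.Nat.DivMod using (_mod_)
open import Data.Product using (∃; _×_)
open import Data.Rational using (ℚ; 0ℚ; 1ℚ; _+_; _≤_; ↥_; ↧ₙ_)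
open import Data.Unit using (⊤)
open import Data.Vec using (Vec; lookup)
open import Data.Vec.Functional using (Vector)
open import Relation.Binary.PropositionalEquality using (_≡_)
open import Relation.Nullary using (does)

sumOver : {A : Set} → List A → (A → ℚ) → ℚ
sumOver xs f = foldr (λ x s → f x + s) 0ℚ xs

syntax sumOver xs (λ x → f) = ∑[ x ∈ xs ] f

record NonNegVector (n : ℕ) : Set where
  constructor nonNegVector
  field
    at     : Vector ℚ n
    nonNeg : ∀ e → 0ℚ ≤ at e

open NonNegVector public

-- The ground set is Fin n, and the family of subsets is a list without
-- repetitions, so that a sum over the list is a sum over the family.
-- The coefficients are rational: since the growth rates are rational, real
-- coefficients exist exactly when rational ones do.  Only the values of coeff
-- on members of 𝓘 are ever used.
record CBGT (n : ℕ) : Set where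
  field
    𝓘          : List (Subset n)
    𝓘-unique   : Unique 𝓘
    rates      : NonNegVector n
    coeff      : Subset n → ℚ
    coeff-≥0   : ∀ I → I List.∈ 𝓘 → 0ℚ ≤ coeff I
    coeff-sum  : ∑[ I ∈ 𝓘 ] coeff I ≡ 1ℚ
    rates-comb : ∀ e → at rates e ≡ ∑[ I ∈ filter (e ∈?_) 𝓘 ] coeff I

-- Days are counted from 0: π t is the set cut on day t + 1.
Schedule : ℕ → Set
Schedule n = ℕ → Subset n

-- dayHeight g π t e is the height of e on day t + 1, before π t is cut.
dayHeight : ∀ {n} → Vector ℚ n → Schedule n → ℕ → Fin n → ℚ
dayHeight g π zero    e = g e
dayHeight g π (suc t) e =
  if does (e ∈? π t) then g e else dayHeight g π t e + g e

-- H = max_e sup_t of the day heights.  A schedule whose heights are unbounded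
-- has infinite height, and then no H satisfies this.
record IsHeight {n} (g : Vector ℚ n) (π : Schedule n) (H : ℚ) : Set where
  field
    upper : ∀ e t → dayHeight g π t e ≤ H
    least : ∀ B → (∀ e t → dayHeight g π t e ≤ B) → H ≤ B

-- H ≤ C log₂ n, for n ≥ 1.  For H = p / q with p ≥ 0 and q > 0 this says
-- p ≤ C q log₂ n, that is 2 ^ p ≤ n ^ (C q); for H < 0 it always holds.
_≤_·log₂_ : ℚ → ℕ → ℕ → Set
H ≤ C ·log₂ n with ↥ H
... | + p      = 2 ℕ.^ p ℕ.≤ n ℕ.^ (C ℕ.* ↧ₙ H)
... | -[1+ _ ] = ⊤

record GoodSchedule (C : ℕ) {n} (X : CBGT n) (π : Schedule n) : Set where
  open CBGT X
  field
    valid    : ∀ t → π t List.∈ 𝓘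
    periodic : ∀ t → π (t ℕ.+ 2 ℕ.* n) ≡ π t
    height≤  : ∃ λ H → IsHeight (at rates) π H × H ≤ C ·log₂ n

weight : ∀ {n} → Vector ℚ n → Subset n → ℚ
weight {n} w I = ∑[ e ∈ filter (_∈? I) (allFin n) ] w e

record Oracle {n} (𝓘 : List (Subset n)) : Set where
  field
    answer  : NonNegVector n → Subset n
    member  : ∀ w → answer w List.∈ 𝓘
    maximum : ∀ w J → J List.∈ 𝓘 → weight (at w) J ≤ weight (at w) (answer w)

-- Adaptive computations that learn about the family only from the answers to
-- their queries.
data OracleComp (n : ℕ) (A : Set) : Set where
  return : A → OracleComp n A
  query  : NonNegVector n → (Subset n → OracleComp n A) → OracleComp n A

module _ {n} {𝓘 : List (Subset n)} (O : Oracle 𝓘) {A : Set} where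
  open Oracle O

  run : OracleComp n A → A
  run (return a)  = a
  run (query w k) = run (k (answer w))

  queryCount : OracleComp n A → ℕ
  queryCount (return a)  = 0
  queryCount (query w k) = suc (queryCount (k (answer w)))

-- An algorithm receives the ground set and the growth rates, neither the
-- family nor the coefficients, and outputs one period of a schedule.
Algorithm : Set
Algorithm = ∀ n → NonNegVector n → OracleComp n (Vec (Subset n) (2 ℕ.* n))

cycle : ∀ {n} → 2 ℕ.≤ n → Vec (Subset n) (2 ℕ.* n) → Schedule n
cycle {suc m} (s≤s _) P t = lookup P (t mod (2 ℕ.* suc m))

{-# OPTIONS --safe #-}
module Submission where

import Algebra.Definitions.RawSemiring as RawSemiringDefs
open import Data.Bool using (true; false; if_then_else_)
open import Data.Fin using (Fin; toℕ)
open import Data.Fin.Properties using (toℕ-fromℕ<; toℕ-injective; toℕ<n)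
open import Data.Fin.Subset using (Subset; _∈_; _∉_)
open import Data.Fin.Subset.Properties using (_∈?_)
import Data.Integer as ℤ
import Data.Integer.Properties as ℤ
open import Data.List using (List; []; _∷_; filter; allFin; length; upTo; cartesianProduct)
import Data.List.Extrema as Extrema
import Data.List.Membership.Propositional as List
open import Data.List.Membership.Propositional.Properties using (∈-allFin; ∈-upTo⁺; ∈-cartesianProduct⁺)
open import Data.List.Properties using (length-tabulate)
import Data.List.Relation.Unary.All as All
open import Data.List.Relation.Unary.Any using (here; there)
open import Data.Nat using (ℕ; zero; suc; z≤n; s≤s)
import Data.Nat as ℕ
import Data.Nat.Coprimality as Coprime
open import Data.Nat.DivMod using (_%_; _/_; _mod_; m%n<n; m≡m%n+[m/n]*n; m<n⇒m%n≡m; [m+n]%n≡m%n)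
open import Data.Nat.GeneralisedArithmetic using (fold)
import Data.Nat.Properties as ℕ
import Data.Nat.Solver
open import Data.Product using (∃; _×_; _,_; proj₁; proj₂)
open import Data.Rational using (ℚ; mkℚ; 0ℚ; 1ℚ; _+_; _*_; -_; _≤_; *≤*; nonNegative)
open import Data.Rational.Properties
open import Data.Rational.Solver using (module +-*-Solver)
import Data.Rational.Unnormalised as ℚᵘ
import Data.Rational.Unnormalised.Properties as ℚᵘ
open import Data.Sum using (_⊎_; inj₁; inj₂)
open import Data.Vec using (Vec; []; _∷_; lookup)
open import Data.Vec.Functional using (Vector)
open import Relation.Binary.Bundles using (module DecTotalOrder)
open import Relation.Binary.PropositionalEquality
open import Relation.Nullary using (does; yes; no; Dec)
open import Relation.Nullary.Decidable using (dec-true; dec-false)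
open import Relation.Unary using (Pred; Decidable)
open import Defs

open Extrema (DecTotalOrder.totalOrder ≤-decTotalOrder) using (argmax; argmax-all; f[xs]≤f[argmax])
open RawSemiringDefs +-*-rawSemiring using (_^_)
open +-*-Solver using (solve; _:=_; _:+_; _:*_; con)
module ℕSolver = Data.Nat.Solver.+-*-Solver

-- Odd and even days are treated separately.  On the even days, cut a set of
-- maximum weight for the weights (1 + g(e))^(a(e) + 1), where a(e) counts the
-- even days since e was last cut by such a set.  The average weight under λ is
-- Σ g(e)(1 + g(e))^(a(e) + 1), and since (1 + g)x ≤ x + g(1 + g)x, the
-- potential Φ = Σ (1 + g(e))^a(e) increases by at most n per step.  Over n
-- steps this gives (1 + g(e))^a(e) ≤ n + n² ≤ n³, that is a(e) g(e) = O(log n).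
-- On the i-th odd day, cut a set containing the i-th element, if there is one;
-- if there is none then its rate is 0.  So every element that grows is cut in
-- each period, and a height never exceeds the sum of two heights from the
-- first period.

-- Naturals inside the rationals, and order arithmetic.

-- Built with `mkℚ` so that numerator and denominator are visible to reduction: `fromℕ 1` is `1ℚ`
-- and `fromℕ 2` is `1ℚ + 1ℚ` by computation.
fromℕ : ℕ → ℚ
fromℕ k = mkℚ (ℤ.+ k) 0 (Coprime.sym (Coprime.1-coprimeTo k))

fromℕ-+ : ∀ a b → fromℕ (a ℕ.+ b) ≡ fromℕ a + fromℕ b
fromℕ-+ a b = toℚᵘ-injective (ℚᵘ.≃-sym (ℚᵘ.≃-trans (toℚᵘ-homo-+ (fromℕ a) (fromℕ b))
  (ℚᵘ.*≡* (cong (ℤ._* ℤ.+ 1) (cong₂ ℤ._+_ (ℤ.*-identityʳ (ℤ.+ a)) (ℤ.*-identityʳ (ℤ.+ b)))))))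

fromℕ-* : ∀ a b → fromℕ (a ℕ.* b) ≡ fromℕ a * fromℕ b
fromℕ-* a b = toℚᵘ-injective (ℚᵘ.≃-sym (ℚᵘ.≃-trans (toℚᵘ-homo-* (fromℕ a) (fromℕ b))
  (ℚᵘ.*≡* (cong (ℤ._* ℤ.+ 1) (sym (ℤ.pos-* a b))))))

fromℕ-mono-≤ : ∀ {a b} → a ℕ.≤ b → fromℕ a ≤ fromℕ b
fromℕ-mono-≤ a≤b = *≤* (ℤ.*-monoʳ-≤-nonNeg (ℤ.+ 1) (ℤ.+≤+ a≤b))

fromℕ-cancel-≤ : ∀ {a b} → fromℕ a ≤ fromℕ b → a ℕ.≤ b
fromℕ-cancel-≤ {a} {b} (*≤* p) = ℤ.drop‿+≤+ (ℤ.*-cancelʳ-≤-pos (ℤ.+ a) (ℤ.+ b) (ℤ.+ 1) p)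

*-monoˡ-≤ : ∀ {p q} r → 0ℚ ≤ r → p ≤ q → r * p ≤ r * q
*-monoˡ-≤ r 0≤r = *-monoˡ-≤-nonNeg r where instance _ = nonNegative 0≤r

*-nonNeg : ∀ {p q} → 0ℚ ≤ p → 0ℚ ≤ q → 0ℚ ≤ p * q
*-nonNeg {p} 0≤p 0≤q = subst (_≤ p * _) (*-zeroʳ p) (*-monoˡ-≤ p 0≤p 0≤q)

0≤1 : 0ℚ ≤ 1ℚ
0≤1 = fromℕ-mono-≤ {0} {1} z≤n

p≤p+q : ∀ {p q} → 0ℚ ≤ q → p ≤ p + q
p≤p+q {p} 0≤q = subst (_≤ p + _) (+-identityʳ p) (+-monoʳ-≤ p 0≤q)

+-cancelʳ-≤ : ∀ {p q} r → p + r ≤ q + r → p ≤ q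
+-cancelʳ-≤ {p} {q} r p+r≤q+r = subst₂ _≤_ (cancel p) (cancel q) (+-monoˡ-≤ (- r) p+r≤q+r)
  where
  cancel : ∀ s → s + r + (- r) ≡ s
  cancel s = trans (+-assoc s r _) (trans (cong (s +_) (+-inverseʳ r)) (+-identityʳ s))

^-nonNeg : ∀ {x} k → 0ℚ ≤ x → 0ℚ ≤ x ^ k
^-nonNeg zero    0≤x = 0≤1
^-nonNeg (suc k) 0≤x = *-nonNeg 0≤x (^-nonNeg k 0≤x)

-- Finite sums.

module _ {A : Set} where

  sum-cong : ∀ {f h : A → ℚ} xs → (∀ x → f x ≡ h x) → sumOver xs f ≡ sumOver xs h
  sum-cong []       f≗h = refl
  sum-cong (x ∷ xs) f≗h = cong₂ _+_ (f≗h x) (sum-cong xs f≗h)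

  sum-mono-∈ : ∀ {f h : A → ℚ} xs → (∀ x → x List.∈ xs → f x ≤ h x) → sumOver xs f ≤ sumOver xs h
  sum-mono-∈ []       f≤h = ≤-refl
  sum-mono-∈ (x ∷ xs) f≤h = +-mono-≤ (f≤h x (here refl)) (sum-mono-∈ xs (λ y y∈ → f≤h y (there y∈)))

  sum-mono : ∀ {f h : A → ℚ} xs → (∀ x → f x ≤ h x) → sumOver xs f ≤ sumOver xs h
  sum-mono xs f≤h = sum-mono-∈ xs (λ x _ → f≤h x)

  sum-+ : ∀ (f h : A → ℚ) xs → sumOver xs (λ x → f x + h x) ≡ sumOver xs f + sumOver xs h
  sum-+ f h []       = refl
  sum-+ f h (x ∷ xs) = trans (cong (f x + h x +_) (sum-+ f h xs))
    (solve 4 (λ a b c d → (a :+ b) :+ (c :+ d) := (a :+ c) :+ (b :+ d))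
      refl (f x) (h x) (sumOver xs f) (sumOver xs h))

  sum-*ʳ : ∀ (f : A → ℚ) c xs → sumOver xs (λ x → f x * c) ≡ sumOver xs f * c
  sum-*ʳ f c []       = sym (*-zeroˡ c)
  sum-*ʳ f c (x ∷ xs) = trans (cong (f x * c +_) (sum-*ʳ f c xs)) (sym (*-distribʳ-+ c (f x) (sumOver xs f)))

  sum-*ˡ : ∀ c (f : A → ℚ) xs → sumOver xs (λ x → c * f x) ≡ c * sumOver xs f
  sum-*ˡ c f []       = sym (*-zeroʳ c)
  sum-*ˡ c f (x ∷ xs) = trans (cong (c * f x +_) (sum-*ˡ c f xs)) (sym (*-distribˡ-+ c (f x) (sumOver xs f)))

  sum-0 : ∀ xs → sumOver {A} xs (λ _ → 0ℚ) ≡ 0ℚ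
  sum-0 []       = refl
  sum-0 (x ∷ xs) = trans (+-identityˡ _) (sum-0 xs)

  sum-1 : ∀ xs → sumOver {A} xs (λ _ → 1ℚ) ≡ fromℕ (length xs)
  sum-1 []       = refl
  sum-1 (x ∷ xs) = trans (cong (_+_ 1ℚ) (sum-1 xs)) (sym (fromℕ-+ 1 (length xs)))

  sum-nonNeg : ∀ {f : A → ℚ} xs → (∀ x → 0ℚ ≤ f x) → 0ℚ ≤ sumOver xs f
  sum-nonNeg {f} xs 0≤f = subst (_≤ sumOver xs f) (sum-0 xs) (sum-mono xs 0≤f)

  term≤sum : ∀ {f : A → ℚ} {x xs} → (∀ x → 0ℚ ≤ f x) → x List.∈ xs → f x ≤ sumOver xs f
  term≤sum {f} {x} {_ ∷ xs} 0≤f (here refl) = p≤p+q {f x} (sum-nonNeg xs 0≤f)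
  term≤sum {f} {x} {y ∷ xs} 0≤f (there x∈xs) =
    ≤-trans (term≤sum 0≤f x∈xs)
      (subst (_≤ f y + sumOver xs f) (+-identityˡ (sumOver xs f)) (+-monoˡ-≤ (sumOver xs f) (0≤f y)))

  sum-filter : ∀ {ℓ} {P : Pred A ℓ} (P? : Decidable P) (f : A → ℚ) xs →
    sumOver (filter P? xs) f ≡ ∑[ x ∈ xs ] (if does (P? x) then f x else 0ℚ)
  sum-filter P? f [] = refl
  sum-filter P? f (x ∷ xs) with does (P? x)
  ... | true  = cong (f x +_) (sum-filter P? f xs)
  ... | false = trans (sum-filter P? f xs) (sym (+-identityˡ _))

sum-swap : ∀ {A B : Set} (f : A → B → ℚ) xs ys →
  ∑[ x ∈ xs ] (∑[ y ∈ ys ] f x y) ≡ ∑[ y ∈ ys ] (∑[ x ∈ xs ] f x y)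
sum-swap f []       ys = sym (sum-0 ys)
sum-swap f (x ∷ xs) ys =
  trans (cong (sumOver ys (f x) +_) (sum-swap f xs ys)) (sym (sum-+ (f x) _ ys))

-- Logarithmic bounds.

-- Each time g has added up to one unit, Bernoulli's inequality
-- (1 + r)(1 + g) ≥ 1 + (r + g) yields another factor 2.
doubling : ∀ {g} → 0ℚ ≤ g → g ≤ 1ℚ → ∀ a → ∃ λ N →
  fromℕ (2 ℕ.^ N) ≤ (1ℚ + g) ^ a × fromℕ a * g ≤ fromℕ (2 ℕ.* N) + 1ℚ
doubling {g} 0≤g g≤1 a = let N , r , 0≤r , r≤1 , lower , upper = invariant a in
  N , ≤-trans (subst (_≤ fromℕ (2 ℕ.^ N) * (1ℚ + r)) (*-identityʳ _)
        (*-monoˡ-≤ _ (fromℕ-mono-≤ z≤n) (p≤p+q 0≤r))) lower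
    , ≤-trans upper (+-monoʳ-≤ _ r≤1)
  where
  open ≤-Reasoning
  0≤1+g : 0ℚ ≤ 1ℚ + g
  0≤1+g = ≤-trans 0≤g (subst (_≤ 1ℚ + g) (+-identityˡ g) (+-monoˡ-≤ g 0≤1))

  Invariant : ℕ → Set
  Invariant a = ∃ λ N → ∃ λ r → 0ℚ ≤ r × r ≤ 1ℚ ×
    fromℕ (2 ℕ.^ N) * (1ℚ + r) ≤ (1ℚ + g) ^ a × fromℕ a * g ≤ fromℕ (2 ℕ.* N) + r

  invariant : ∀ a → Invariant a
  invariant zero = 0 , 0ℚ , ≤-refl , 0≤1 , ≤-refl , ≤-reflexive (*-zeroˡ g)
  invariant (suc a) with invariant a
  ... | N , r , 0≤r , r≤1 , lower , upper = wrap (≤-total (r + g) 1ℚ)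
    where
    0≤r+g : 0ℚ ≤ r + g
    0≤r+g = ≤-trans 0≤r (p≤p+q 0≤g)
    lower′ : fromℕ (2 ℕ.^ N) * (1ℚ + (r + g)) ≤ (1ℚ + g) ^ suc a
    lower′ = begin
      fromℕ (2 ℕ.^ N) * (1ℚ + (r + g))
        ≤⟨ *-monoˡ-≤ _ (fromℕ-mono-≤ {0} {2 ℕ.^ N} z≤n) (p≤p+q {1ℚ + (r + g)} (*-nonNeg 0≤r 0≤g)) ⟩
      fromℕ (2 ℕ.^ N) * (1ℚ + (r + g) + r * g)
        ≡⟨ solve 3 (λ t r g → t :* (con 1ℚ :+ (r :+ g) :+ r :* g) := (con 1ℚ :+ g) :* (t :* (con 1ℚ :+ r)))
             refl (fromℕ (2 ℕ.^ N)) r g ⟩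
      (1ℚ + g) * (fromℕ (2 ℕ.^ N) * (1ℚ + r))
        ≤⟨ *-monoˡ-≤ _ 0≤1+g lower ⟩
      (1ℚ + g) * (1ℚ + g) ^ a ∎
    upper′ : fromℕ (suc a) * g ≤ fromℕ (2 ℕ.* N) + (r + g)
    upper′ = begin
      fromℕ (suc a) * g         ≡⟨ cong (_* g) (fromℕ-+ 1 a) ⟩
      (1ℚ + fromℕ a) * g        ≡⟨ solve 2 (λ x g → (con 1ℚ :+ x) :* g := x :* g :+ g) refl (fromℕ a) g ⟩
      fromℕ a * g + g           ≤⟨ +-monoˡ-≤ g upper ⟩
      fromℕ (2 ℕ.* N) + r + g   ≡⟨ +-assoc (fromℕ (2 ℕ.* N)) r g ⟩
      fromℕ (2 ℕ.* N) + (r + g) ∎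
    wrap : _ → Invariant (suc a)
    wrap (inj₁ r+g≤1) = N , r + g , 0≤r+g , r+g≤1 , lower′ , upper′
    -- The remainder restarts at 0 instead of `r + g - 1`. Since `r + g` may be as large as 2, one
    -- doubling is charged with two units, whence `2 * N`.
    wrap (inj₂ 1≤r+g) = suc N , 0ℚ , ≤-refl , 0≤1 , ≤-trans (begin
      fromℕ (2 ℕ.^ suc N) * (1ℚ + 0ℚ)  ≡⟨ *-identityʳ _ ⟩
      fromℕ (2 ℕ.* 2 ℕ.^ N)            ≡⟨ fromℕ-* 2 (2 ℕ.^ N) ⟩
      fromℕ 2 * fromℕ (2 ℕ.^ N)        ≡⟨ *-comm (fromℕ 2) (fromℕ (2 ℕ.^ N)) ⟩
      fromℕ (2 ℕ.^ N) * (1ℚ + 1ℚ)      ≤⟨ *-monoˡ-≤ _ (fromℕ-mono-≤ z≤n) (+-monoʳ-≤ 1ℚ 1≤r+g) ⟩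
      fromℕ (2 ℕ.^ N) * (1ℚ + (r + g)) ∎) lower′
      , (begin
      fromℕ (suc a) * g                ≤⟨ upper′ ⟩
      fromℕ (2 ℕ.* N) + (r + g)        ≤⟨ +-monoʳ-≤ _ (+-mono-≤ r≤1 g≤1) ⟩
      fromℕ (2 ℕ.* N) + (1ℚ + 1ℚ)      ≡⟨ fromℕ-+ (2 ℕ.* N) 2 ⟨
      fromℕ (2 ℕ.* N ℕ.+ 2)            ≡⟨ cong fromℕ (trans (ℕ.+-comm (2 ℕ.* N) 2) (sym (ℕ.*-suc 2 N))) ⟩
      fromℕ (2 ℕ.* suc N)              ≡⟨ +-identityʳ _ ⟨
      fromℕ (2 ℕ.* suc N) + 0ℚ         ∎)

-- A natural number between `q` and `C log₂ n`. Such bounds are added and weakened without looking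
-- at numerators and denominators, which `_≤_·log₂_` would require.
record _≲_·log₂_ (q : ℚ) (C n : ℕ) : Set where
  constructor below
  field
    exponent   : ℕ
    ≤exponent  : q ≤ fromℕ exponent
    2^exponent : 2 ℕ.^ exponent ℕ.≤ n ℕ.^ C

≲⇒≤·log₂ : ∀ {H C n} → H ≲ C ·log₂ n → H ≤ C ·log₂ n
≲⇒≤·log₂ {mkℚ ℤ.-[1+ _ ] _ _} _ = _
≲⇒≤·log₂ {mkℚ (ℤ.+ p) d-1 _} {C} {n} (below N (*≤* p≤Nd) 2^N≤n^C) = begin
  2 ℕ.^ p                   ≤⟨ ℕ.^-monoʳ-≤ 2 p≤N*d ⟩
  2 ℕ.^ (N ℕ.* d)           ≡⟨ ℕ.^-*-assoc 2 N d ⟨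
  (2 ℕ.^ N) ℕ.^ d           ≤⟨ ℕ.^-monoˡ-≤ d 2^N≤n^C ⟩
  (n ℕ.^ C) ℕ.^ d           ≡⟨ ℕ.^-*-assoc n C d ⟩
  n ℕ.^ (C ℕ.* d)           ∎
  where
  open ℕ.≤-Reasoning
  d = suc d-1
  p≤N*d : p ℕ.≤ N ℕ.* d
  p≤N*d = ℤ.drop‿+≤+ (subst₂ ℤ._≤_ (ℤ.*-identityʳ (ℤ.+ p)) (sym (ℤ.pos-* N d)) p≤Nd)

≲-resp-≥ : ∀ {p q C n} → p ≤ q → q ≲ C ·log₂ n → p ≲ C ·log₂ n
≲-resp-≥ p≤q (below N q≤N bound) = below N (≤-trans p≤q q≤N) bound

≲-+ : ∀ {p q C D n} → p ≲ C ·log₂ n → q ≲ D ·log₂ n → (p + q) ≲ C ℕ.+ D ·log₂ n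
≲-+ {p} {q} {C} {D} {n} (below M p≤M boundM) (below N q≤N boundN) = below (M ℕ.+ N)
  (subst (p + q ≤_) (sym (fromℕ-+ M N)) (+-mono-≤ p≤M q≤N))
  (subst₂ ℕ._≤_ (sym (ℕ.^-distribˡ-+-* 2 M N)) (sym (ℕ.^-distribˡ-+-* n C D)) (ℕ.*-mono-≤ boundM boundN))

-- The quantity bounded is the height allowed at age `a`, two days of growth per unit of age. If
-- `2 ^ N ≤ (1 + g) ^ a`, then `a g ≤ 2 N + 1` by `doubling`; with `g ≤ 1` the quantity is at most
-- `2 (2 N + 2)`. The summand 4 in the exponent of `n` absorbs `2 ^ 4`, as `2 ≤ n`.
≲-age : ∀ {n g} C a → 2 ℕ.≤ n → 0ℚ ≤ g → g ≤ 1ℚ → (1ℚ + g) ^ a ≤ fromℕ (n ℕ.^ C) →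
  (fromℕ (suc a) * (g + g)) ≲ C ℕ.* 4 ℕ.+ 4 ·log₂ n
≲-age {n} {g} C a 2≤n 0≤g g≤1 pow≤ with N , 2^N≤pow , ag≤ ← doubling 0≤g g≤1 a =
  below (N ℕ.* 4 ℕ.+ 4) value bound
  where
  half : fromℕ a * g + g ≤ fromℕ (2 ℕ.* N ℕ.+ 2)
  half = subst (fromℕ a * g + g ≤_)
    (trans (+-assoc (fromℕ (2 ℕ.* N)) 1ℚ 1ℚ) (sym (fromℕ-+ (2 ℕ.* N) 2))) (+-mono-≤ ag≤ g≤1)

  value : fromℕ (suc a) * (g + g) ≤ fromℕ (N ℕ.* 4 ℕ.+ 4)
  value = begin
    fromℕ (suc a) * (g + g)                       ≡⟨ cong (_* (g + g)) (fromℕ-+ 1 a) ⟩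
    (1ℚ + fromℕ a) * (g + g)                      ≡⟨ solve 2 (λ x g →
      (con 1ℚ :+ x) :* (g :+ g) := (x :* g :+ g) :+ (x :* g :+ g)) refl (fromℕ a) g ⟩
    (fromℕ a * g + g) + (fromℕ a * g + g)         ≤⟨ +-mono-≤ half half ⟩
    fromℕ (2 ℕ.* N ℕ.+ 2) + fromℕ (2 ℕ.* N ℕ.+ 2) ≡⟨ fromℕ-+ (2 ℕ.* N ℕ.+ 2) (2 ℕ.* N ℕ.+ 2) ⟨
    fromℕ ((2 ℕ.* N ℕ.+ 2) ℕ.+ (2 ℕ.* N ℕ.+ 2))   ≡⟨ cong fromℕ (ℕSolver.solve 1 (λ N →
      (con′ 2 :*′ N :+′ con′ 2) :+′ (con′ 2 :*′ N :+′ con′ 2) :=′ N :*′ con′ 4 :+′ con′ 4) refl N) ⟩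
    fromℕ (N ℕ.* 4 ℕ.+ 4)                         ∎
    where
    open ≤-Reasoning
    open ℕSolver using () renaming (_:*_ to _:*′_; _:+_ to _:+′_; _:=_ to _:=′_; con to con′)

  bound : 2 ℕ.^ (N ℕ.* 4 ℕ.+ 4) ℕ.≤ n ℕ.^ (C ℕ.* 4 ℕ.+ 4)
  bound = begin
    2 ℕ.^ (N ℕ.* 4 ℕ.+ 4)       ≡⟨ ℕ.^-distribˡ-+-* 2 (N ℕ.* 4) 4 ⟩
    2 ℕ.^ (N ℕ.* 4) ℕ.* 2 ℕ.^ 4 ≡⟨ cong (ℕ._* 2 ℕ.^ 4) (ℕ.^-*-assoc 2 N 4) ⟨
    (2 ℕ.^ N) ℕ.^ 4 ℕ.* 2 ℕ.^ 4 ≤⟨ ℕ.*-mono-≤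
      (ℕ.^-monoˡ-≤ 4 (fromℕ-cancel-≤ (≤-trans 2^N≤pow pow≤))) (ℕ.^-monoˡ-≤ 4 2≤n) ⟩
    (n ℕ.^ C) ℕ.^ 4 ℕ.* n ℕ.^ 4 ≡⟨ cong (ℕ._* n ℕ.^ 4) (ℕ.^-*-assoc n C 4) ⟩
    n ℕ.^ (C ℕ.* 4) ℕ.* n ℕ.^ 4 ≡⟨ ℕ.^-distribˡ-+-* n (C ℕ.* 4) 4 ⟨
    n ℕ.^ (C ℕ.* 4 ℕ.+ 4)       ∎
    where open ℕ.≤-Reasoning

-- Heights under a periodic schedule.

module _ {n} (g : Vector ℚ n) (π : Schedule n) (e : Fin n) (0≤g : 0ℚ ≤ g e) where

  private
    h : ℕ → ℚ
    h t = dayHeight g π t e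

  dayHeight-nonNeg : ∀ t → 0ℚ ≤ h t
  dayHeight-nonNeg zero = 0≤g
  dayHeight-nonNeg (suc t) with does (e ∈? π t)
  ... | true  = 0≤g
  ... | false = ≤-trans (dayHeight-nonNeg t) (p≤p+q 0≤g)

  dayHeight-zero : g e ≡ 0ℚ → ∀ t → h t ≡ 0ℚ
  dayHeight-zero g≡0 zero = g≡0
  dayHeight-zero g≡0 (suc t) with does (e ∈? π t)
  ... | true  = g≡0
  ... | false = cong₂ _+_ (dayHeight-zero g≡0 t) g≡0

  module _ {T} (periodic : ∀ t → π (t ℕ.+ T) ≡ π t) where

    -- Both heights undergo the same cuts. Until the first cut the later one stays ahead by less
    -- than `h T` or exactly `h T`; a cut makes them equal.
    dayHeight-shift : ∀ t → h (t ℕ.+ T) ≤ h T + h t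
    dayHeight-shift zero = p≤p+q 0≤g
    dayHeight-shift (suc t) rewrite periodic t with does (e ∈? π t)
    ... | true  = subst (_≤ h T + g e) (+-identityˡ (g e)) (+-monoˡ-≤ (g e) (dayHeight-nonNeg T))
    ... | false = subst (h (t ℕ.+ T) + g e ≤_) (+-assoc (h T) (h t) (g e)) (+-monoˡ-≤ (g e) (dayHeight-shift t))

    module _ {s} (e∈πs : e ∈ π s) where

      -- A cut on day index `s` erases the past, so the heights at `suc s` and `suc s + T` are both
      -- `g e`, and from there on they evolve alike.
      dayHeight-periodic : ∀ u → h (u ℕ.+ suc s ℕ.+ T) ≡ h (u ℕ.+ suc s)
      dayHeight-periodic zero rewrite periodic s | dec-true (e ∈? π s) e∈πs = refl
      dayHeight-periodic (suc u) rewrite periodic (u ℕ.+ suc s) with does (e ∈? π (u ℕ.+ suc s))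
      ... | true  = refl
      ... | false = cong (_+ g e) (dayHeight-periodic u)

      dayHeight-periodic* : ∀ u k → h (u ℕ.+ k ℕ.* T ℕ.+ suc s) ≡ h (u ℕ.+ suc s)
      dayHeight-periodic* u zero    = cong (λ v → h (v ℕ.+ suc s)) (ℕ.+-identityʳ u)
      dayHeight-periodic* u (suc k) = trans (cong h (ℕSolver.solve 4 (λ u k T s →
          u :+′ (T :+′ k) :+′ s :=′ u :+′ k :+′ s :+′ T) refl u (k ℕ.* T) T (suc s)))
        (trans (dayHeight-periodic (u ℕ.+ k ℕ.* T)) (dayHeight-periodic* u k))
        where open ℕSolver using () renaming (_:+_ to _:+′_; _:=_ to _:=′_)

      -- Every height already occurs within the first two periods, so the supremum over all days is
      -- a maximum over finitely many. Days up to `s` stay put; a later day is reduced modulo `T`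
      -- counting from `suc s`.
      dayHeight-recurs : .{{_ : ℕ.NonZero T}} → s ℕ.< T → ∀ t → ∃ λ t′ → t′ ℕ.< T ℕ.+ T × h t ≡ h t′
      dayHeight-recurs s<T t with t ℕ.≤? s
      ... | yes t≤s = t , ℕ.≤-trans (ℕ.s≤s t≤s) (ℕ.≤-trans s<T (ℕ.m≤m+n T T)) , refl
      ... | no  t≰s = u % T ℕ.+ suc s , ℕ.+-mono-≤ (m%n<n u T) s<T
        , (begin
          h t                                     ≡⟨ cong h (ℕ.m∸n+n≡m (ℕ.≰⇒> t≰s)) ⟨
          h (u ℕ.+ suc s)                         ≡⟨ cong (λ v → h (v ℕ.+ suc s)) (m≡m%n+[m/n]*n u T) ⟩
          h (u % T ℕ.+ u / T ℕ.* T ℕ.+ suc s)     ≡⟨ dayHeight-periodic* (u % T) (u / T) ⟩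
          h (u % T ℕ.+ suc s)                     ∎)
        where
        open ≡-Reasoning
        u = t ℕ.∸ suc s

-- Heights bounded by ages.

bump : ∀ {n} → Subset n → Vector ℕ n → Vector ℕ n
bump I age e = if does (e ∈? I) then 0 else suc (age e)

-- Day 2i carries the i-th greedy set, day 2i + 1 an arbitrary one.
module _ {n} (g : Vector ℚ n) (π : Schedule n) (e : Fin n) (0≤g : 0ℚ ≤ g e)
         (age : ℕ → Vector ℕ n) (age-zero : age 0 e ≡ 0) where

  private
    bound : ℕ → ℚ
    bound i = fromℕ (suc (age i e)) * (g e + g e)

    h : ℕ → ℚ
    h t = dayHeight g π t e

  module _ {m} (age-suc : ∀ i → i ℕ.< m → age (suc i) e ≡ bump (π (i ℕ.* 2)) (age i) e) where

    -- The extra `g e` on the left pays for the following odd day in the worst case, when its set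
    -- misses `e`. After a greedy cut the two sides are both `g e + g e`.
    dayHeight-odd : ∀ i → i ℕ.< m → h (i ℕ.* 2) ≤ bound i → h (suc (i ℕ.* 2)) + g e ≤ bound (suc i)
    dayHeight-odd i i<m h≤ rewrite age-suc i i<m with does (e ∈? π (i ℕ.* 2))
    ... | true  = ≤-reflexive (sym (*-identityˡ (g e + g e)))
    ... | false = begin
      h (i ℕ.* 2) + g e + g e                        ≡⟨ +-assoc (h (i ℕ.* 2)) (g e) (g e) ⟩
      h (i ℕ.* 2) + (g e + g e)                      ≤⟨ +-monoˡ-≤ (g e + g e) h≤ ⟩
      bound i + (g e + g e)                          ≡⟨ solve 2 (λ x y →
        x :* y :+ y := (con 1ℚ :+ x) :* y) refl (fromℕ (suc (age i e))) (g e + g e) ⟩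
      (1ℚ + fromℕ (suc (age i e))) * (g e + g e)     ≡⟨ cong (_* (g e + g e)) (fromℕ-+ 1 (suc (age i e))) ⟨
      fromℕ (suc (suc (age i e))) * (g e + g e)      ∎
      where open ≤-Reasoning

    dayHeight-even : ∀ i → i ℕ.≤ m → h (i ℕ.* 2) ≤ bound i
    dayHeight-even zero _ rewrite age-zero =
      subst (g e ≤_) (sym (*-identityˡ (g e + g e))) (p≤p+q 0≤g)
    dayHeight-even (suc i) i<m = ≤-trans step (dayHeight-odd i i<m (dayHeight-even i (ℕ.<⇒≤ i<m)))
      where
      step : h (suc (suc (i ℕ.* 2))) ≤ h (suc (i ℕ.* 2)) + g e
      step with does (e ∈? π (suc (i ℕ.* 2)))
      ... | true  = subst (_≤ h (suc (i ℕ.* 2)) + g e) (+-identityˡ (g e))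
                      (+-monoˡ-≤ (g e) (dayHeight-nonNeg g π e 0≤g (suc (i ℕ.* 2))))
      ... | false = ≤-refl

    dayHeight≤age : ∀ t → t ℕ.≤ m ℕ.* 2 → ∃ λ i → i ℕ.≤ m × h t ≤ bound i
    dayHeight≤age t t≤m*2 with even-or-odd t
      where
      even-or-odd : ∀ t → ∃ λ i → t ≡ i ℕ.* 2 ⊎ t ≡ suc (i ℕ.* 2)
      even-or-odd zero = 0 , inj₁ refl
      even-or-odd (suc t) with even-or-odd t
      ... | i , inj₁ t≡ = i , inj₂ (cong suc t≡)
      ... | i , inj₂ t≡ = suc i , inj₁ (cong suc t≡)
    ... | i , inj₁ refl = i , i≤m , dayHeight-even i i≤m
      where i≤m = ℕ.*-cancelʳ-≤ i m 2 t≤m*2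
    ... | i , inj₂ refl = suc i , i<m , ≤-trans (p≤p+q 0≤g) (dayHeight-odd i i<m (dayHeight-even i (ℕ.<⇒≤ i<m)))
      where i<m = ℕ.*-cancelʳ-< 2 i m t≤m*2

-- Oracle computations that collect answers.

module _ {n : ℕ} {A B : Set} (f : A → B) where

  mapComp : OracleComp n A → OracleComp n B
  mapComp (return a)  = return (f a)
  mapComp (query w k) = query w (λ I → mapComp (k I))

  module _ {𝓘 : List (Subset n)} (O : Oracle 𝓘) where

    run-mapComp : ∀ c → run O (mapComp c) ≡ f (run O c)
    run-mapComp (return a)  = refl
    run-mapComp (query w k) = run-mapComp (k (Oracle.answer O w))

    queryCount-mapComp : ∀ c → queryCount O (mapComp c) ≡ queryCount O c
    queryCount-mapComp (return a)  = refl
    queryCount-mapComp (query w k) = cong suc (queryCount-mapComp (k (Oracle.answer O w)))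

module _ {n : ℕ} {S : Set} (next : S → NonNegVector n) (step : S → Subset n → S) where

  collect : ∀ k → S → OracleComp n (Vec (Subset n) k)
  collect zero    s = return []
  collect (suc k) s = query (next s) (λ I → mapComp (I ∷_) (collect k (step s I)))

  module _ {𝓘 : List (Subset n)} (O : Oracle 𝓘) where

    queryCount-collect : ∀ k s → queryCount O (collect k s) ≡ k
    queryCount-collect zero    s = refl
    queryCount-collect (suc k) s =
      cong suc (trans (queryCount-mapComp (_ ∷_) O (collect k _)) (queryCount-collect k _))

    advance : S → S
    advance s = step s (Oracle.answer O (next s))

    -- Starting from the state after `t` steps makes the induction go through: `fold` applies the
    -- newest step outermost, so one more query leads definitionally from the state at `t` to the
    -- state at `suc t`.
    lookup-collect : ∀ k s t i → lookup (run O (collect k (fold s advance t))) i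
                                 ≡ Oracle.answer O (next (fold s advance (t ℕ.+ toℕ i)))
    lookup-collect (suc k) s t i = trans
      (cong (λ P → lookup P i) (run-mapComp (_ ∷_) O (collect k (fold s advance (suc t))))) (at-index i)
      where
      at-index : ∀ i → lookup (Oracle.answer O (next (fold s advance t))
                                 ∷ run O (collect k (fold s advance (suc t)))) i
                       ≡ Oracle.answer O (next (fold s advance (t ℕ.+ toℕ i)))
      at-index Fin.zero    = cong (λ u → Oracle.answer O (next (fold s advance u))) (sym (ℕ.+-identityʳ t))
      at-index (Fin.suc i) = trans (lookup-collect k s (suc t) i)
        (cong (λ u → Oracle.answer O (next (fold s advance u))) (sym (ℕ.+-suc t (toℕ i))))

-- The algorithm.

-- greedy i is the state before day 2i, cover i the state before day 2i + 1.
data State (n : ℕ) : Set where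
  greedy : ℕ → Vector ℕ n → State n
  cover  : ℕ → Vector ℕ n → State n

-- The weight of `e` is its term in the next potential if it is left uncut.
ageWeights : ∀ {n} → NonNegVector n → Vector ℕ n → NonNegVector n
ageWeights g age = nonNegVector (λ e → (1ℚ + at g e) ^ suc (age e))
  (λ e → ^-nonNeg (suc (age e)) (≤-trans 0≤1 (p≤p+q (nonNeg g e))))

-- The indicator of the `i`-th element: a maximizing set contains that element as soon as some
-- member of the family does.
unitWeights : ∀ {n} → ℕ → NonNegVector n
unitWeights i = nonNegVector (λ e → if does (toℕ e ℕ.≟ i) then 1ℚ else 0ℚ)
  (λ e → if-nonNeg (does (toℕ e ℕ.≟ i)))
  where
  if-nonNeg : ∀ b → 0ℚ ≤ (if b then 1ℚ else 0ℚ)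
  if-nonNeg true  = 0≤1
  if-nonNeg false = ≤-refl

weights : ∀ {n} → NonNegVector n → State n → NonNegVector n
weights g (greedy i age) = ageWeights g age
weights g (cover  i age) = unitWeights i

-- A covering set does not reset ages. They may therefore overestimate the time since the last cut,
-- which is harmless for upper bounds on heights.
update : ∀ {n} → State n → Subset n → State n
update (greedy i age) I = cover i (bump I age)
update (cover  i age) I = greedy (suc i) age

start : ∀ {n} → State n
start = greedy 0 (λ _ → 0)

trimming : Algorithm
trimming n g = collect (weights g) update (2 ℕ.* n) start

-- `cycle` reduces only when the proof of `2 ≤ n` is matched; doing so here lets the analysis keep
-- `n` abstract.
cycle-lookup : ∀ {n} (2≤n : 2 ℕ.≤ n) P t .{{_ : ℕ.NonZero (2 ℕ.* n)}} →
  cycle 2≤n P t ≡ lookup P (t mod (2 ℕ.* n))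
cycle-lookup (s≤s _) P t = refl

-- Analysis of the algorithm.

module Analysis {n} (2≤n : 2 ℕ.≤ n) (X : CBGT n) (O : Oracle (CBGT.𝓘 X)) where
  open CBGT X
  open Oracle O

  private
    instance
      n≢0 : ℕ.NonZero n
      n≢0 = ℕ.>-nonZero (ℕ.≤-trans (s≤s z≤n) 2≤n)

      2n≢0 : ℕ.NonZero (2 ℕ.* n)
      2n≢0 = ℕ.m*n≢0 2 n

    g : Vector ℚ n
    g = at rates

    π : Schedule n
    π = cycle 2≤n (run O (trimming n rates))

    state : ℕ → State n
    state = fold start (advance (weights rates) update O)

    age : ℕ → Vector ℕ n
    age zero    = λ _ → 0
    age (suc i) = bump (answer (ageWeights rates (age i))) (age i)

    Φ : ℕ → ℚ
    Φ i = ∑[ e ∈ allFin n ] ((1ℚ + g e) ^ age i e)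

  -- Swapping the sums over elements and sets turns the left side into the average of the set
  -- weights with coefficients `coeff`, and an average is at most the maximum.
  average≤maximum : ∀ (w : NonNegVector n) → ∑[ e ∈ allFin n ] (g e * at w e) ≤ weight (at w) (answer w)
  average≤maximum w = begin
    ∑[ e ∈ allFin n ] (g e * at w e)
      ≡⟨ sum-cong (allFin n) (λ e → trans (cong (_* at w e) (trans (rates-comb e) (sum-filter (e ∈?_) coeff 𝓘)))
                                          (sym (sum-*ʳ (λ I → if does (e ∈? I) then coeff I else 0ℚ) (at w e) 𝓘))) ⟩
    ∑[ e ∈ allFin n ] (∑[ I ∈ 𝓘 ] ((if does (e ∈? I) then coeff I else 0ℚ) * at w e))
      ≡⟨ sum-swap (λ e I → (if does (e ∈? I) then coeff I else 0ℚ) * at w e) (allFin n) 𝓘 ⟩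
    ∑[ I ∈ 𝓘 ] (∑[ e ∈ allFin n ] ((if does (e ∈? I) then coeff I else 0ℚ) * at w e))
      ≡⟨ sum-cong 𝓘 (λ I → trans
           (sum-cong (allFin n) (λ e → move-if (does (e ∈? I)) (coeff I) (at w e)))
           (trans (sum-*ˡ (coeff I) (λ e → if does (e ∈? I) then at w e else 0ℚ) (allFin n))
                  (cong (coeff I *_) (sym (sum-filter (_∈? I) (at w) (allFin n)))))) ⟩
    ∑[ I ∈ 𝓘 ] (coeff I * weight (at w) I)
      ≤⟨ sum-mono-∈ 𝓘 (λ I I∈𝓘 → *-monoˡ-≤ (coeff I) (coeff-≥0 I I∈𝓘) (maximum w I I∈𝓘)) ⟩
    ∑[ I ∈ 𝓘 ] (coeff I * weight (at w) (answer w))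
      ≡⟨ sum-*ʳ coeff (weight (at w) (answer w)) 𝓘 ⟩
    sumOver 𝓘 coeff * weight (at w) (answer w)
      ≡⟨ cong (_* weight (at w) (answer w)) coeff-sum ⟩
    1ℚ * weight (at w) (answer w)
      ≡⟨ *-identityˡ (weight (at w) (answer w)) ⟩
    weight (at w) (answer w) ∎
    where
    open ≤-Reasoning
    move-if : ∀ b c x → (if b then c else 0ℚ) * x ≡ c * (if b then x else 0ℚ)
    move-if true  c x = refl
    move-if false c x = trans (*-zeroˡ x) (sym (*-zeroʳ c))

  rates≤1 : ∀ e → g e ≤ 1ℚ
  rates≤1 e = begin
    g e
      ≡⟨ trans (rates-comb e) (sum-filter (e ∈?_) coeff 𝓘) ⟩
    ∑[ I ∈ 𝓘 ] (if does (e ∈? I) then coeff I else 0ℚ)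
      ≤⟨ sum-mono-∈ 𝓘 (λ I I∈𝓘 → drop-if (does (e ∈? I)) (coeff-≥0 I I∈𝓘)) ⟩
    sumOver 𝓘 coeff
      ≡⟨ coeff-sum ⟩
    1ℚ ∎
    where
    open ≤-Reasoning
    drop-if : ∀ b {c} → 0ℚ ≤ c → (if b then c else 0ℚ) ≤ c
    drop-if true  0≤c = ≤-refl
    drop-if false 0≤c = 0≤c

  -- For the indicator of `e` the average weight is `g e`, while an answer that misses `e` has
  -- weight 0.
  rate-zero : ∀ e → e ∉ answer (unitWeights (toℕ e)) → g e ≡ 0ℚ
  rate-zero e e∉I = ≤-antisym (begin
    g e
      ≡⟨ trans (cong (λ b → g e * (if b then 1ℚ else 0ℚ)) (dec-true (toℕ e ℕ.≟ toℕ e) refl))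
               (*-identityʳ (g e)) ⟨
    g e * at w e
      ≤⟨ term≤sum (λ e′ → *-nonNeg (nonNeg rates e′) (nonNeg w e′)) (∈-allFin e) ⟩
    ∑[ e′ ∈ allFin n ] (g e′ * at w e′)
      ≤⟨ average≤maximum w ⟩
    weight (at w) I
      ≡⟨ sum-filter (_∈? I) (at w) (allFin n) ⟩
    ∑[ e′ ∈ allFin n ] (if does (e′ ∈? I) then at w e′ else 0ℚ)
      ≡⟨ sum-cong (allFin n) vanish ⟩
    ∑[ e′ ∈ allFin n ] 0ℚ
      ≡⟨ sum-0 (allFin n) ⟩
    0ℚ ∎) (nonNeg rates e)
    where
    open ≤-Reasoning
    w = unitWeights (toℕ e)
    I = answer w
    vanish : ∀ e′ → (if does (e′ ∈? I) then at w e′ else 0ℚ) ≡ 0ℚ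
    vanish e′ with e′ ∈? I
    ... | no  _    = refl
    ... | yes e′∈I = cong (λ b → if b then 1ℚ else 0ℚ)
      (dec-false (toℕ e′ ℕ.≟ toℕ e) (λ eq → e∉I (subst (_∈ I) (toℕ-injective eq) e′∈I)))

  -- Adding `W` to both sides avoids subtraction and allows comparison term by term. An uncut
  -- element contributes exactly `at w e` to the left side, a cut one `1 + at w e`. On the right the
  -- average weight appears, which is at most `W`, and `W` cancels.
  Φ-suc : ∀ i → Φ (suc i) ≤ Φ i + fromℕ n
  Φ-suc i = +-cancelʳ-≤ W (begin
    Φ (suc i) + W
      ≡⟨ cong (Φ (suc i) +_) (sum-filter (_∈? I) (at w) (allFin n)) ⟩
    Φ (suc i) + ∑[ e ∈ allFin n ] (if does (e ∈? I) then at w e else 0ℚ)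
      ≡⟨ sum-+ (λ e → (1ℚ + g e) ^ age (suc i) e) (λ e → if does (e ∈? I) then at w e else 0ℚ) (allFin n) ⟨
    ∑[ e ∈ allFin n ] ((1ℚ + g e) ^ age (suc i) e + (if does (e ∈? I) then at w e else 0ℚ))
      ≤⟨ sum-mono (allFin n) cut ⟩
    ∑[ e ∈ allFin n ] (((1ℚ + g e) ^ age i e + g e * at w e) + 1ℚ)
      ≡⟨ trans (sum-+ (λ e → (1ℚ + g e) ^ age i e + g e * at w e) (λ _ → 1ℚ) (allFin n))
               (cong₂ _+_ (sum-+ (λ e → (1ℚ + g e) ^ age i e) (λ e → g e * at w e) (allFin n))
                          (trans (sum-1 (allFin n)) (cong fromℕ (length-tabulate {n = n} (λ e → e))))) ⟩
    Φ i + ∑[ e ∈ allFin n ] (g e * at w e) + fromℕ n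
      ≤⟨ +-monoˡ-≤ (fromℕ n) (+-monoʳ-≤ (Φ i) (average≤maximum w)) ⟩
    Φ i + W + fromℕ n
      ≡⟨ solve 3 (λ a b c → a :+ b :+ c := a :+ c :+ b) refl (Φ i) W (fromℕ n) ⟩
    Φ i + fromℕ n + W ∎)
    where
    open ≤-Reasoning
    w = ageWeights rates (age i)
    I = answer w
    W = weight (at w) I
    grow : ∀ e → at w e ≤ (1ℚ + g e) ^ age i e + g e * at w e
    grow e = begin
      (1ℚ + g e) * x                ≡⟨ solve 2 (λ g x → (con 1ℚ :+ g) :* x := x :+ g :* x) refl (g e) x ⟩
      x + g e * x                   ≤⟨ +-monoʳ-≤ x (*-monoˡ-≤ (g e) (nonNeg rates e) (subst (x ≤_)
                                         (solve 2 (λ g x → x :+ g :* x := (con 1ℚ :+ g) :* x) refl (g e) x)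
                                         (p≤p+q (*-nonNeg (nonNeg rates e) 0≤x)))) ⟩
      x + g e * ((1ℚ + g e) * x)    ∎
      where
      x = (1ℚ + g e) ^ age i e
      0≤x = ^-nonNeg (age i e) (≤-trans 0≤1 (p≤p+q {1ℚ} (nonNeg rates e)))
    cut : ∀ e → (1ℚ + g e) ^ age (suc i) e + (if does (e ∈? I) then at w e else 0ℚ)
                ≤ ((1ℚ + g e) ^ age i e + g e * at w e) + 1ℚ
    cut e with does (e ∈? I)
    ... | true  = subst (_≤ (1ℚ + g e) ^ age i e + g e * at w e + 1ℚ) (+-comm (at w e) 1ℚ)
                        (+-monoˡ-≤ 1ℚ (grow e))
    ... | false = +-mono-≤ (grow e) 0≤1

  Φ-bound : ∀ i → Φ i ≤ fromℕ (n ℕ.+ i ℕ.* n)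
  Φ-bound zero = ≤-reflexive (trans (sum-1 (allFin n))
    (cong fromℕ (trans (length-tabulate {n = n} (λ e → e)) (sym (ℕ.+-identityʳ n)))))
  Φ-bound (suc i) = begin
    Φ (suc i)                         ≤⟨ Φ-suc i ⟩
    Φ i + fromℕ n                     ≤⟨ +-monoˡ-≤ (fromℕ n) (Φ-bound i) ⟩
    fromℕ (n ℕ.+ i ℕ.* n) + fromℕ n   ≡⟨ fromℕ-+ (n ℕ.+ i ℕ.* n) n ⟨
    fromℕ (n ℕ.+ i ℕ.* n ℕ.+ n)       ≡⟨ cong fromℕ (ℕ.+-comm (n ℕ.+ i ℕ.* n) n) ⟩
    fromℕ (n ℕ.+ suc i ℕ.* n)         ∎
    where open ≤-Reasoning

  -- One term is at most the whole potential. The case `i = n` is included because the height at the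
  -- end of the period, on day index `2 * n`, depends on it.
  age-bound : ∀ i e → i ℕ.≤ n → (1ℚ + g e) ^ age i e ≤ fromℕ (n ℕ.^ 3)
  age-bound i e i≤n = begin
    (1ℚ + g e) ^ age i e
      ≤⟨ term≤sum (λ e → ^-nonNeg (age i e) (≤-trans 0≤1 (p≤p+q (nonNeg rates e)))) (∈-allFin e) ⟩
    Φ i
      ≤⟨ Φ-bound i ⟩
    fromℕ (suc i ℕ.* n)
      ≤⟨ fromℕ-mono-≤ (ℕ.*-monoˡ-≤ n 1+i≤n*n) ⟩
    fromℕ (n ℕ.* n ℕ.* n)
      ≡⟨ cong fromℕ (ℕSolver.solve 1 (λ n → n :*′ n :*′ n :=′ n :^′ 3) refl n) ⟩
    fromℕ (n ℕ.^ 3) ∎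
    where
    open ≤-Reasoning
    open ℕSolver using () renaming (_:*_ to _:*′_; _:^_ to _:^′_; _:=_ to _:=′_)
    1+i≤n*n : suc i ℕ.≤ n ℕ.* n
    -- The chain is `1 + i ≤ n + n = 2 * n ≤ n * n`.
    1+i≤n*n = ℕ.≤-trans (ℕ.+-mono-≤ (ℕ.≤-trans (s≤s z≤n) 2≤n) i≤n)
      (ℕ.≤-trans (ℕ.≤-reflexive (cong (n ℕ.+_) (sym (ℕ.+-identityʳ n)))) (ℕ.*-monoˡ-≤ n 2≤n))

  schedule : ∀ t → π t ≡ answer (weights rates (state (t % (2 ℕ.* n))))
  schedule t = trans (cycle-lookup 2≤n _ t) (trans
    (lookup-collect (weights rates) update O (2 ℕ.* n) start 0 (t mod (2 ℕ.* n)))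
    (cong (λ u → answer (weights rates (state u))) (toℕ-fromℕ< (m%n<n t (2 ℕ.* n)))))

  valid : ∀ t → π t List.∈ 𝓘
  valid t = subst (List._∈ 𝓘) (sym (schedule t)) (member (weights rates (state (t % (2 ℕ.* n)))))

  periodic : ∀ t → π (t ℕ.+ 2 ℕ.* n) ≡ π t
  periodic t = trans (schedule (t ℕ.+ 2 ℕ.* n)) (trans
    (cong (λ u → answer (weights rates (state u))) ([m+n]%n≡m%n t (2 ℕ.* n))) (sym (schedule t)))

  schedule-< : ∀ t → t ℕ.< 2 ℕ.* n → π t ≡ answer (weights rates (state t))
  schedule-< t t<2n = trans (schedule t) (cong (λ u → answer (weights rates (state u))) (m<n⇒m%n≡m t<2n))

  state-even : ∀ i → state (i ℕ.* 2) ≡ greedy i (age i)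
  state-even zero    = refl
  state-even (suc i) =
    cong (λ s → advance (weights rates) update O (advance (weights rates) update O s)) (state-even i)

  i*2+1<2n : ∀ {i} → i ℕ.< n → suc (i ℕ.* 2) ℕ.< 2 ℕ.* n
  i*2+1<2n {i} i<n = subst (suc i ℕ.* 2 ℕ.≤_) (ℕ.*-comm n 2) (ℕ.*-monoˡ-≤ 2 i<n)

  schedule-even : ∀ i → i ℕ.< n → π (i ℕ.* 2) ≡ answer (ageWeights rates (age i))
  schedule-even i i<n = trans (schedule-< (i ℕ.* 2) (ℕ.<-trans (ℕ.n<1+n _) (i*2+1<2n i<n)))
    (cong (λ s → answer (weights rates s)) (state-even i))

  schedule-odd : ∀ i → i ℕ.< n → π (suc (i ℕ.* 2)) ≡ answer (unitWeights i)
  schedule-odd i i<n = trans (schedule-< (suc (i ℕ.* 2)) (i*2+1<2n i<n))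
    (cong (λ s → answer (weights rates (advance (weights rates) update O s))) (state-even i))

  -- The schedule is known to follow `age` only during the first period, since afterwards it repeats
  -- while `age` goes on. The exponent 3 of `age-bound` gives `16 = 3 * 4 + 4`.
  first-period : ∀ e t → t ℕ.≤ 2 ℕ.* n → dayHeight g π t e ≲ 16 ·log₂ n
  first-period e t t≤2n =
    let i , i≤n , h≤ = dayHeight≤age g π e (nonNeg rates e) age refl
          (λ i i<n → cong (λ I → bump I (age i) e) (sym (schedule-even i i<n)))
          t (subst (t ℕ.≤_) (ℕ.*-comm 2 n) t≤2n)
    in ≲-resp-≥ h≤ (≲-age 3 (age i e) 2≤n (nonNeg rates e) (rates≤1 e) (age-bound i e i≤n))

  recurs : ∀ e t → ∃ λ t′ → t′ ℕ.< 2 ℕ.* n ℕ.+ 2 ℕ.* n × dayHeight g π t e ≡ dayHeight g π t′ e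
  recurs e t with e ∈? answer (unitWeights (toℕ e))
  ... | yes e∈I = dayHeight-recurs g π e (nonNeg rates e) periodic
    (subst (e ∈_) (sym (schedule-odd (toℕ e) (toℕ<n e))) e∈I) (i*2+1<2n (toℕ<n e)) t
  -- An element missed by its covering set has rate 0, so its height is always 0 and day index 0
  -- represents every day.
  ... | no  e∉I = 0 , ℕ.≤-trans (ℕ.>-nonZero⁻¹ (2 ℕ.* n)) (ℕ.m≤m+n (2 ℕ.* n) (2 ℕ.* n))
    , trans (zero-height t) (sym (zero-height 0))
    where zero-height = dayHeight-zero g π e (nonNeg rates e) (rate-zero e e∉I)

  dayHeight-bound : ∀ e t → dayHeight g π t e ≲ 32 ·log₂ n
  dayHeight-bound e t with recurs e t
  ... | t′ , t′<2T , eq = ≲-resp-≥ (≤-reflexive eq) (cases (t′ ℕ.≤? T))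
    where
    T = 2 ℕ.* n
    h = λ t → dayHeight g π t e
    cases : Dec (t′ ℕ.≤ T) → h t′ ≲ 32 ·log₂ n
    -- A single bound with constant 16 holds here; the nonnegative summand `h T` is added to reach
    -- the common constant `32 = 16 + 16`.
    cases (yes t′≤T) = ≲-resp-≥ (p≤p+q (dayHeight-nonNeg g π e (nonNeg rates e) T))
      (≲-+ (first-period e t′ t′≤T) (first-period e T ℕ.≤-refl))
    cases (no t′≰T) = ≲-resp-≥
      (subst (λ u → h u ≤ h T + h (t′ ℕ.∸ T)) (ℕ.m∸n+n≡m (ℕ.<⇒≤ (ℕ.≰⇒> t′≰T)))
        (dayHeight-shift g π e (nonNeg rates e) periodic (t′ ℕ.∸ T)))
      (≲-+ (first-period e T ℕ.≤-refl)
           (first-period e (t′ ℕ.∸ T)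
             (ℕ.≤-trans (ℕ.∸-monoˡ-≤ T (ℕ.<⇒≤ t′<2T)) (ℕ.≤-reflexive (ℕ.m+n∸n≡m T T)))))

  good : GoodSchedule 32 X π
  good = record
    { valid    = valid
    ; periodic = periodic
    ; height≤  = H , record { upper = upper ; least = λ B h≤B → h≤B (proj₁ peak) (proj₂ peak) }
               , ≲⇒≤·log₂ (dayHeight-bound (proj₁ peak) (proj₂ peak))
    }
    where
    days = cartesianProduct (allFin n) (upTo (2 ℕ.* n ℕ.+ 2 ℕ.* n))
    height : Fin n × ℕ → ℚ
    height (e , t) = dayHeight g π t e
    peak : Fin n × ℕ
    -- The default is a genuine element and day, so `H` is an attained height in every case; this is
    -- what makes it the least upper bound.
    peak = argmax height (0 mod n , 0) days
    H : ℚ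
    H = height peak
    upper : ∀ e t → dayHeight g π t e ≤ H
    upper e t with recurs e t
    ... | t′ , t′<2T , eq = subst (_≤ H) (sym eq)
      (All.lookup (f[xs]≤f[argmax] {f = height} (0 mod n , 0) days)
                  (∈-cartesianProduct⁺ (∈-allFin e) (∈-upTo⁺ t′<2T)))

-- Existence without a given oracle.

-- For an empty family `coeff-sum` would say that 0 equals 1.
nonempty : ∀ {n} (X : CBGT n) → ∃ λ I → I List.∈ CBGT.𝓘 X
nonempty X with CBGT.𝓘 X | CBGT.coeff-sum X
... | []    | ()
... | I ∷ _ | _ = I , here refl

-- The existence claim comes with no oracle. As the family is a finite list, searching it supplies
-- one, and the analysis of the algorithm applies.
exhaustiveOracle : ∀ {n} (X : CBGT n) → Oracle (CBGT.𝓘 X)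
exhaustiveOracle X with I , I∈𝓘 ← nonempty X = record
  { answer  = λ w → argmax (weight (at w)) I 𝓘
  ; member  = λ w → argmax-all (weight (at w)) {P = List._∈ 𝓘} I∈𝓘 (All.tabulate (λ J∈𝓘 → J∈𝓘))
  ; maximum = λ w J J∈𝓘 → All.lookup (f[xs]≤f[argmax] {f = weight (at w)} I 𝓘) J∈𝓘
  }
  where open CBGT X

theorem5p7 : ∃ λ (C : ℕ) → 0 ℕ.< C
    × (∀ n → 2 ℕ.≤ n → (X : CBGT n) → ∃ λ (π : Schedule n) → GoodSchedule C X π)
    × (∃ λ (alg : Algorithm) → ∀ n → (n≥2 : 2 ℕ.≤ n) → (X : CBGT n) → (O : Oracle (CBGT.𝓘 X)) →
    queryCount O (alg n (CBGT.rates X)) ℕ.≤ 2 ℕ.* n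
    × GoodSchedule C X (cycle n≥2 (run O (alg n (CBGT.rates X)))))
theorem5p7 = 32 , s≤s z≤n
  , (λ n n≥2 X → _ , Analysis.good n≥2 X (exhaustiveOracle X))
  , trimming , λ n n≥2 X O →
      ℕ.≤-reflexive (queryCount-collect (weights (CBGT.rates X)) update O (2 ℕ.* n) start)
      , Analysis.good n≥2 X O
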